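{- Let $\alpha$ be an irrational real number. If the irrationality exponent $\mu(\alpha)$ is finite, then the irrationality base satisfies $\beta(\alpha)=1$; equivalently, if the irrationality base of $\alpha$ exceeds $1$, then $\alpha$ is a Liouville number. In particular, a super Liouville number is also a Liouville number.
   Context: Let $\alpha$ be an irrational real number. Irrationality exponent: if there exists $\mu>0$ with the property that for any $\varepsilon>0$ there is a positive integer $q(\varepsilon)$ such that $\left|\alpha-\frac pq\right|>\frac{1}{q^{\mu+\varepsilon}}$ for all integers $p,q$ with $q\ge q(\varepsilon)$, then the least such $\mu$ is denoted $\mu(\alpha)$ and called the irrationality exponent of $\alpha$. If no such $\mu$ exists, one writes $\mu(\alpha)=\infty$ and calls $\alpha$ a Liouville number. Irrationality base: if there exists a real number $\beta\ge 1$ with the property that for any $\varepsilon>0$ there is a positive integer $q(\varepsilon)$ such that $\left|\alpha-\frac pq\right|>\frac{1}{(\beta+\varepsilon)^q}$ for all integers $p,q$ with $q\ge q(\varepsilon)$, then the least such $\beta$ is denoted $\beta(\alpha)$ and called the irrationality base of $\alpha$. If no such $\beta$ exists, one writes $\beta(\alpha)=\infty$ and calls $\alpha$ a super Liouville number. -}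

module Defs where

open import Algebra.Bundles using (CommutativeRing)
open import Data.Empty using (⊥)
open import Data.Integer.Base as ℤ using (ℤ; +_; -[1+_])
import Data.Integer.Properties as ℤ
open import Data.Nat.Base as ℕ using (ℕ; zero; suc)
import Data.Nat.Properties as ℕ
open import Data.Product.Base using (∃; ∃-syntax; _×_; _,_; proj₁; proj₂)
open import Data.Rational.Base as ℚ using (ℚ; 0ℚ; 1ℚ; mkℚ; toℚᵘ)
import Data.Rational.Properties as ℚ
import Data.Rational.Unnormalised.Base as ℚᵘ
import Data.Rational.Unnormalised.Properties as ℚᵘ
open import Data.Rational.Solver using (module +-*-Solver)
open import Data.Sum.Base using (_⊎_; inj₁; inj₂)
open import Data.Unit.Base using (⊤)
open import Relation.Binary.PropositionalEquality
  using (_≡_; refl; sym; trans; cong; cong₂; subst; subst₂)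
open import Relation.Nullary using (¬_; yes; no; contradiction)

module ℚ-Lemmas where

  open import Data.Rational.Base using (_<_; _≤_; _+_; _*_; _-_; -_)
  open +-*-Solver

  open import Algebra.Properties.CommutativeSemiring.Exp
    (CommutativeRing.commutativeSemiring ℚ.+-*-commutativeRing) public
    using (_^_; ^-homo-*; ^-assocʳ; ^-distrib-*)

  fromℕ : ℕ → ℚ
  fromℕ zero    = 0ℚ
  fromℕ (suc n) = 1ℚ + fromℕ n

  -- Abstract, since `with` would otherwise normalise large rational terms.
  abstract
    0<1 : 0ℚ < 1ℚ
    0<1 = ℚ.*<* (ℤ.+<+ (ℕ.s≤s ℕ.z≤n))

    ≤⊎> : ∀ p q → p ≤ q ⊎ q < p
    ≤⊎> p q with p ℚ.≤? q
    ... | yes p≤q = inj₁ p≤q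
    ... | no  p≰q = inj₂ (ℚ.≰⇒> p≰q)

    *-monoˡ-< : ∀ {r p q} → 0ℚ < r → p < q → r * p < r * q
    *-monoˡ-< {r} 0<r = ℚ.*-monoʳ-<-pos r {{ℚ.positive 0<r}}

    *-monoʳ-< : ∀ {r p q} → 0ℚ < r → p < q → p * r < q * r
    *-monoʳ-< {r} 0<r = ℚ.*-monoˡ-<-pos r {{ℚ.positive 0<r}}

    *-monoˡ-≤ : ∀ {r p q} → 0ℚ ≤ r → p ≤ q → r * p ≤ r * q
    *-monoˡ-≤ {r} 0≤r = ℚ.*-monoˡ-≤-nonNeg r {{ℚ.nonNegative 0≤r}}

    *-monoʳ-≤ : ∀ {r p q} → 0ℚ ≤ r → p ≤ q → p * r ≤ q * r
    *-monoʳ-≤ {r} 0≤r = ℚ.*-monoʳ-≤-nonNeg r {{ℚ.nonNegative 0≤r}}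

    *-cancelˡ-< : ∀ {r p q} → 0ℚ < r → r * p < r * q → p < q
    *-cancelˡ-< {r} 0<r =
      ℚ.*-cancelˡ-<-nonNeg r {{ℚ.pos⇒nonNeg r {{ℚ.positive 0<r}}}}

    *-cancelʳ-< : ∀ {r p q} → 0ℚ < r → p * r < q * r → p < q
    *-cancelʳ-< {r} 0<r =
      ℚ.*-cancelʳ-<-nonNeg r {{ℚ.pos⇒nonNeg r {{ℚ.positive 0<r}}}}

    *-pos : ∀ {p q} → 0ℚ < p → 0ℚ < q → 0ℚ < p * q
    *-pos {p} {q} 0<p 0<q = subst (_< p * q) (ℚ.*-zeroʳ p) (*-monoˡ-< 0<p 0<q)

    *-pos⁻¹ : ∀ {p q} → 0ℚ < q → 0ℚ < p * q → 0ℚ < p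
    *-pos⁻¹ {p} {q} 0<q 0<pq = *-cancelʳ-< 0<q (subst (_< p * q) (sym (ℚ.*-zeroˡ q)) 0<pq)

    +-pos : ∀ {p q} → 0ℚ < p → 0ℚ < q → 0ℚ < p + q
    +-pos = ℚ.+-mono-<

    p<q⇒0<q-p : ∀ {p q} → p < q → 0ℚ < q - p
    p<q⇒0<q-p {p} {q} p<q = subst (_< q - p) (ℚ.+-inverseʳ p) (ℚ.+-monoˡ-< (- p) p<q)

    p<p+q : ∀ p {q} → 0ℚ < q → p < p + q
    p<p+q p {q} 0<q = subst (_< p + q) (ℚ.+-identityʳ p) (ℚ.+-monoʳ-< p 0<q)

    p≤p+q : ∀ p {q} → 0ℚ ≤ q → p ≤ p + q
    p≤p+q p {q} 0≤q = subst (_≤ p + q) (ℚ.+-identityʳ p) (ℚ.+-monoʳ-≤ p 0≤q)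

    p-1<p : ∀ p → p - 1ℚ < p
    p-1<p p = subst (p - 1ℚ <_) (ℚ.+-identityʳ p) (ℚ.+-monoʳ-< p (ℚ.neg-antimono-< 0<1))

    neg-invol : ∀ p → - (- p) ≡ p
    neg-invol = solve 1 (λ p → :- (:- p) := p) refl

    <-neg : ∀ {p q} → p < - q → q < - p
    <-neg {p} {q} p<-q = subst (_< - p) (neg-invol q) (ℚ.neg-antimono-< p<-q)

    neg-< : ∀ {p q} → - p < q → - q < p
    neg-< {p} {q} -p<q = subst (- q <_) (neg-invol p) (ℚ.neg-antimono-< -p<q)

    inverse : ∀ {p} → 0ℚ < p → ∃[ i ] (0ℚ < i × p * i ≡ 1ℚ)
    inverse {p} 0<p = ℚ.1/_ p {{p≢0}} , 0<1/p , ℚ.*-inverseʳ p {{p≢0}}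
      where
      p≢0 : ℚ.NonZero p
      p≢0 = ℚ.>-nonZero 0<p
      0<1/p : 0ℚ < ℚ.1/_ p {{p≢0}}
      0<1/p = ℚ.positive⁻¹ (ℚ.1/_ p {{p≢0}}) {{ℚ.1/pos⇒pos p {{ℚ.positive 0<p}}}}

    quotient : ∀ p {q} → 0ℚ < q → ∃[ r ] r * q ≡ p
    quotient p {q} 0<q with inverse 0<q
    ... | i , _ , qi≡1 = p * i , trans (ℚ.*-assoc p i q)
      (trans (cong (p *_) (trans (ℚ.*-comm i q) qi≡1)) (ℚ.*-identityʳ p))

    quotient-pos : ∀ {p q} → 0ℚ < p → 0ℚ < q → ∃[ r ] (0ℚ < r × r * q ≡ p)
    quotient-pos {p} 0<p 0<q with quotient p 0<q
    ... | r , rq≡p = r , *-pos⁻¹ 0<q (subst (0ℚ <_) (sym rq≡p) 0<p) , rq≡p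

    suc-/1 : ∀ n → + suc n ℚ./ 1 ≡ 1ℚ + + n ℚ./ 1
    suc-/1 n = ℚ.toℚᵘ-injective (begin-equality
      toℚᵘ (+ suc n ℚ./ 1)               ≃⟨ ℚ.toℚᵘ-fromℚᵘ (ℚᵘ.mkℚᵘ (+ suc n) 0) ⟩
      ℚᵘ.mkℚᵘ (+ suc n) 0                ≃⟨ ℚᵘ.*≡* (cong (ℤ._* + 1) (sym lem)) ⟩
      ℚᵘ.mkℚᵘ (+ 1) 0 ℚᵘ.+ ℚᵘ.mkℚᵘ (+ n) 0
        ≃⟨ ℚᵘ.+-cong {ℚᵘ.mkℚᵘ (+ 1) 0} ℚᵘ.≃-refl
                     (ℚᵘ.≃-sym (ℚ.toℚᵘ-fromℚᵘ (ℚᵘ.mkℚᵘ (+ n) 0))) ⟩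
      toℚᵘ 1ℚ ℚᵘ.+ toℚᵘ (+ n ℚ./ 1)      ≃⟨ ℚ.toℚᵘ-homo-+ 1ℚ (+ n ℚ./ 1) ⟨
      toℚᵘ (1ℚ + + n ℚ./ 1)              ∎)
      where
      open ℚᵘ.≤-Reasoning
      lem : + 1 ℤ.* + 1 ℤ.+ + n ℤ.* + 1 ≡ + suc n
      lem = cong (λ z → + 1 ℤ.+ z) (ℤ.*-identityʳ (+ n))

    fromℕ≡/1 : ∀ n → fromℕ n ≡ + n ℚ./ 1
    fromℕ≡/1 zero    = refl
    fromℕ≡/1 (suc n) = trans (cong (_+_ 1ℚ) (fromℕ≡/1 n)) (sym (suc-/1 n))

    fromℕ≥0 : ∀ n → 0ℚ ≤ fromℕ n
    fromℕ≥0 zero    = ℚ.≤-refl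
    fromℕ≥0 (suc n) = ℚ.≤-trans (ℚ.<⇒≤ 0<1) (p≤p+q 1ℚ (fromℕ≥0 n))

    1≤fromℕ : ∀ n .{{_ : ℕ.NonZero n}} → 1ℚ ≤ fromℕ n
    1≤fromℕ (suc n) = p≤p+q 1ℚ (fromℕ≥0 n)

    fromℕ-* : ∀ a n → fromℕ a * (+ 1 ℚ./ suc n) ≡ + a ℚ./ suc n
    fromℕ-* a n = trans (cong (_* (+ 1 ℚ./ suc n)) (fromℕ≡/1 a)) (ℚ.toℚᵘ-injective (begin-equality
      toℚᵘ (+ a ℚ./ 1 * (+ 1 ℚ./ suc n))  ≃⟨ ℚ.toℚᵘ-homo-* (+ a ℚ./ 1) (+ 1 ℚ./ suc n) ⟩
      toℚᵘ (+ a ℚ./ 1) ℚᵘ.* toℚᵘ (+ 1 ℚ./ suc n)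
        ≃⟨ ℚᵘ.*-cong (ℚ.toℚᵘ-fromℚᵘ (ℚᵘ.mkℚᵘ (+ a) 0))
                     (ℚ.toℚᵘ-fromℚᵘ (ℚᵘ.mkℚᵘ (+ 1) n)) ⟩
      ℚᵘ.mkℚᵘ (+ a) 0 ℚᵘ.* ℚᵘ.mkℚᵘ (+ 1) n
        ≃⟨ ℚᵘ.*≡* (cong₂ ℤ._*_ (ℤ.*-identityʳ (+ a)) (sym (ℤ.*-identityˡ (+ suc n)))) ⟩
      ℚᵘ.mkℚᵘ (+ a) n                     ≃⟨ ℚ.toℚᵘ-fromℚᵘ (ℚᵘ.mkℚᵘ (+ a) n) ⟨
      toℚᵘ (+ a ℚ./ suc n)                ∎))
      where open ℚᵘ.≤-Reasoning

    1/suc-pos : ∀ n → 0ℚ < + 1 ℚ./ suc n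
    1/suc-pos n = ℚ.positive⁻¹ (+ 1 ℚ./ suc n) {{ℚ.normalize-pos 1 (suc n)}}

    /-<⇒ : ∀ a m b n → + a ℚ./ suc m < + b ℚ./ suc n → a ℕ.* suc n ℕ.< b ℕ.* suc m
    /-<⇒ a m b n lt = ℤ.drop‿+<+ (subst₂ ℤ._<_ (sym (ℤ.pos-* a (suc n))) (sym (ℤ.pos-* b (suc m)))
      (ℚᵘ.drop-*<* (ℚᵘ.<-respˡ-≃ (ℚ.toℚᵘ-fromℚᵘ (ℚᵘ.mkℚᵘ (+ a) m))
        (ℚᵘ.<-respʳ-≃ (ℚ.toℚᵘ-fromℚᵘ (ℚᵘ.mkℚᵘ (+ b) n)) (ℚ.toℚᵘ-mono-< lt)))))

    quarter : ∀ {p} → 0ℚ < p → ∃[ d ] (0ℚ < d × (d + d) + (d + d) < p)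
    quarter {p} 0<p = d , 0<d , subst ((d + d) + (d + d) <_) 5d≡p (p<p+q _ 0<d)
      where
      d : ℚ
      d = + 1 ℚ./ 5 * p
      0<d : 0ℚ < d
      0<d = *-pos (1/suc-pos 4) 0<p
      5d≡p : (d + d) + (d + d) + d ≡ p
      5d≡p = solve 1 (λ p → let d = con (+ 1 ℚ./ 5) :* p in
        (d :+ d) :+ (d :+ d) :+ d := p) refl p

    archimedean : ∀ p → ∃[ n ] p ≤ fromℕ n
    archimedean p@(mkℚ (+ a) d _) = a , subst (p ≤_) (sym (fromℕ≡/1 a)) (ℚ.toℚᵘ-cancel-≤
      (ℚᵘ.≤-respʳ-≃ (ℚᵘ.≃-sym (ℚ.toℚᵘ-fromℚᵘ (ℚᵘ.mkℚᵘ (+ a) 0)))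
        (ℚᵘ.*≤* (ℤ.*-monoˡ-≤-nonNeg (+ a) {+ 1} {+ suc d} (ℤ.+≤+ (ℕ.s≤s ℕ.z≤n))))))
    archimedean (mkℚ -[1+ _ ] _ _) = 0 , ℚ.*≤* ℤ.-≤+

    archimedean-* : ∀ p {q} → 0ℚ < q → ∃[ n ] p ≤ fromℕ n * q
    archimedean-* p {q} 0<q with quotient p 0<q
    ... | r , rq≡p with archimedean r
    ... | n , r≤n = n , subst (_≤ fromℕ n * q) rq≡p (*-monoʳ-≤ (ℚ.<⇒≤ 0<q) r≤n)

  open ℚ.≤-Reasoning

  abstract
    ^-pos : ∀ {p} n → 0ℚ < p → 0ℚ < p ^ n
    ^-pos zero    0<p = 0<1
    ^-pos (suc n) 0<p = *-pos 0<p (^-pos n 0<p)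

    ^-monoˡ-≤ : ∀ {p q} n → 0ℚ < p → p ≤ q → p ^ n ≤ q ^ n
    ^-monoˡ-≤ zero    0<p p≤q = ℚ.≤-refl
    ^-monoˡ-≤ {p} {q} (suc n) 0<p p≤q = begin
      p * p ^ n  ≤⟨ *-monoʳ-≤ (ℚ.<⇒≤ (^-pos n 0<p)) p≤q ⟩
      q * p ^ n  ≤⟨ *-monoˡ-≤ (ℚ.<⇒≤ (ℚ.<-≤-trans 0<p p≤q)) (^-monoˡ-≤ n 0<p p≤q) ⟩
      q * q ^ n  ∎

    ^-monoˡ-< : ∀ {p q} n → 0ℚ < p → p < q → p ^ suc n < q ^ suc n
    ^-monoˡ-< {p} {q} n 0<p p<q = begin-strict
      p * p ^ n  <⟨ *-monoʳ-< (^-pos n 0<p) p<q ⟩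
      q * p ^ n  ≤⟨ *-monoˡ-≤ (ℚ.<⇒≤ (ℚ.<-trans 0<p p<q)) (^-monoˡ-≤ n 0<p (ℚ.<⇒≤ p<q)) ⟩
      q * q ^ n  ∎

    ^-cancelˡ-≤ : ∀ {p q} n → 0ℚ < q → p ^ suc n ≤ q ^ suc n → p ≤ q
    ^-cancelˡ-≤ {p} {q} n 0<q p^n≤q^n with ≤⊎> p q
    ... | inj₁ p≤q = p≤q
    ... | inj₂ q<p = contradiction (ℚ.<-≤-trans (^-monoˡ-< n 0<q q<p) p^n≤q^n)
                                   (ℚ.<-irrefl refl)

    1≤^ : ∀ {p} n → 1ℚ ≤ p → 1ℚ ≤ p ^ n
    1≤^ zero    1≤p = ℚ.≤-refl
    1≤^ {p} (suc n) 1≤p = begin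
      1ℚ         ≤⟨ 1≤^ n 1≤p ⟩
      p ^ n      ≡⟨ ℚ.*-identityˡ (p ^ n) ⟨
      1ℚ * p ^ n ≤⟨ *-monoʳ-≤ (ℚ.≤-trans (ℚ.<⇒≤ 0<1) (1≤^ n 1≤p)) 1≤p ⟩
      p * p ^ n  ∎

    ^-monoʳ-≤ : ∀ {p m n} → 1ℚ ≤ p → m ℕ.≤ n → p ^ m ≤ p ^ n
    ^-monoʳ-≤ {n = n} 1≤p ℕ.z≤n = 1≤^ n 1≤p
    ^-monoʳ-≤ 1≤p (ℕ.s≤s m≤n) =
      *-monoˡ-≤ (ℚ.≤-trans (ℚ.<⇒≤ 0<1) 1≤p) (^-monoʳ-≤ 1≤p m≤n)

    bernoulli : ∀ {h} n → 0ℚ < h → 1ℚ + fromℕ n * h ≤ (1ℚ + h) ^ n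
    bernoulli {h} zero 0<h =
      ℚ.≤-reflexive (trans (cong (_+_ 1ℚ) (ℚ.*-zeroˡ h)) (ℚ.+-identityʳ 1ℚ))
    bernoulli {h} (suc n) 0<h = begin
      1ℚ + (1ℚ + fromℕ n) * h
        ≤⟨ p≤p+q _ (subst (_≤ fromℕ n * (h * h)) (ℚ.*-zeroʳ (fromℕ n))
                      (*-monoˡ-≤ (fromℕ≥0 n) (ℚ.<⇒≤ (*-pos 0<h 0<h)))) ⟩
      1ℚ + (1ℚ + fromℕ n) * h + fromℕ n * (h * h)
        ≡⟨ solve 2 (λ m k → con 1ℚ :+ (con 1ℚ :+ m) :* k :+ m :* (k :* k)
                        := (con 1ℚ :+ k) :* (con 1ℚ :+ m :* k)) refl (fromℕ n) h ⟩
      (1ℚ + h) * (1ℚ + fromℕ n * h)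
        ≤⟨ *-monoˡ-≤ (ℚ.<⇒≤ (+-pos 0<1 0<h)) (bernoulli n 0<h) ⟩
      (1ℚ + h) * (1ℚ + h) ^ n ∎

    ^-grows : ∀ k {p q} → 0ℚ < p → p < q → ∃[ n ] k * p ^ suc n ≤ q ^ suc n
    ^-grows k {p} {q} 0<p p<q
      with quotient-pos (p<q⇒0<q-p p<q) 0<p
    ... | h , 0<h , hp≡q-p with archimedean-* k 0<h
    ... | n , k≤nh = n , (begin
      k * p ^ suc n                 ≤⟨ *-monoʳ-≤ (ℚ.<⇒≤ (^-pos (suc n) 0<p)) k≤ ⟩
      (1ℚ + h) ^ suc n * p ^ suc n  ≡⟨ ^-distrib-* (1ℚ + h) p (suc n) ⟨
      ((1ℚ + h) * p) ^ suc n        ≡⟨ cong (_^ suc n) lem ⟩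
      q ^ suc n                     ∎)
      where
      k≤ : k ≤ (1ℚ + h) ^ suc n
      k≤ = begin
        k                  ≤⟨ k≤nh ⟩
        fromℕ n * h        ≤⟨ p≤p+q _ (ℚ.<⇒≤ 0<1) ⟩
        fromℕ n * h + 1ℚ   ≡⟨ ℚ.+-comm (fromℕ n * h) 1ℚ ⟩
        1ℚ + fromℕ n * h   ≤⟨ bernoulli n 0<h ⟩
        (1ℚ + h) ^ n       ≤⟨ ^-monoʳ-≤ (p≤p+q 1ℚ (ℚ.<⇒≤ 0<h)) (ℕ.n≤1+n n) ⟩
        (1ℚ + h) ^ suc n   ∎
      lem : (1ℚ + h) * p ≡ q
      lem = trans (solve 2 (λ h p → (con 1ℚ :+ h) :* p := h :* p :+ p) refl h p)
           (trans (cong (_+ p) hp≡q-p)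
                  (solve 2 (λ p q → q :- p :+ p := q) refl p q))

    sum-bound : ∀ p q a b e → a + b ≤ p → e + e < q - p → (a + e) + (b + e) < q
    sum-bound p q a b e a+b≤p 2e<q-p = begin-strict
      (a + e) + (b + e)
        ≡⟨ solve 3 (λ a b e → (a :+ e) :+ (b :+ e) := (a :+ b) :+ (e :+ e)) refl a b e ⟩
      (a + b) + (e + e)
        <⟨ ℚ.+-mono-≤-< a+b≤p 2e<q-p ⟩
      p + (q - p)
        ≡⟨ solve 2 (λ p q → p :+ (q :- p) := q) refl p q ⟩
      q ∎

    ratio-bound : ∀ u v a a₀ d e → u < v → a₀ ≤ a → 0ℚ < e →
      (e + e) + (e + e) < (v - u) * a₀ → d * u ≡ e → u * (a + (d + d)) < v * a
    ratio-bound u v a a₀ d e u<v a₀≤a 0<e 4e< du≡e = begin-strict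
      u * (a + (d + d))
        ≡⟨ solve 3 (λ u a d → u :* (a :+ (d :+ d)) := u :* a :+ (d :* u :+ d :* u)) refl u a d ⟩
      u * a + (d * u + d * u)
        ≡⟨ cong (λ e → u * a + (e + e)) du≡e ⟩
      u * a + (e + e)
        <⟨ ℚ.+-monoʳ-< (u * a) (ℚ.<-trans (p<p+q (e + e) (+-pos 0<e 0<e)) 4e<) ⟩
      u * a + (v - u) * a₀
        ≤⟨ ℚ.+-monoʳ-≤ (u * a) (*-monoˡ-≤ (ℚ.<⇒≤ (p<q⇒0<q-p u<v)) a₀≤a) ⟩
      u * a + (v - u) * a
        ≡⟨ solve 3 (λ u v a → u :* a :+ (v :- u) :* a := v :* a) refl u v a ⟩
      v * a ∎

    product-bound : ∀ p m q a b c d → 0ℚ < p → p < m → m < q → 0ℚ < a → 0ℚ < d →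
      p * c < m * a → m * d < q * b → a * b ≤ p → c * d < q
    product-bound p m q a b c d 0<p p<m m<q 0<a 0<d pc<ma md<qb ab≤p =
      *-cancelˡ-< 0<p (*-cancelˡ-< 0<m (begin-strict
      m * (p * (c * d))
        ≡⟨ solve 4 (λ m p c d → m :* (p :* (c :* d)) := (p :* c) :* (m :* d)) refl m p c d ⟩
      (p * c) * (m * d)
        <⟨ *-monoʳ-< (*-pos 0<m 0<d) pc<ma ⟩
      (m * a) * (m * d)
        <⟨ *-monoˡ-< (*-pos 0<m 0<a) md<qb ⟩
      (m * a) * (q * b)
        ≡⟨ solve 4 (λ m a q b → (m :* a) :* (q :* b) := (m :* q) :* (a :* b)) refl m a q b ⟩
      (m * q) * (a * b)
        ≤⟨ *-monoˡ-≤ (ℚ.<⇒≤ (*-pos 0<m (ℚ.<-trans 0<m m<q))) ab≤p ⟩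
      (m * q) * p
        ≡⟨ solve 3 (λ m p q → (m :* q) :* p := m :* (p :* q)) refl m p q ⟩
      m * (p * q) ∎))
      where
      0<m : 0ℚ < m
      0<m = ℚ.<-trans 0<p p<m

open ℚ-Lemmas

-- Two-sided, located Dedekind cuts; `lower x p` means p < x.
record ℝ : Set₁ where
  field
    lower upper     : ℚ → Set
    lower-inhabited : ∃ lower
    upper-inhabited : ∃ upper
    lower-open      : ∀ {p} → lower p → ∃[ q ] (p ℚ.< q × lower q)
    upper-open      : ∀ {q} → upper q → ∃[ p ] (p ℚ.< q × upper p)
    ordered         : ∀ {p q} → lower p → upper q → p ℚ.< q
    located         : ∀ {p q} → p ℚ.< q → lower p ⊎ upper q

  lower-closed : ∀ {p q} → p ℚ.< q → lower q → lower p
  lower-closed p<q Lq with located p<q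
  ... | inj₁ Lp = Lp
  ... | inj₂ Uq = contradiction (ordered Lq Uq) (ℚ.<-irrefl refl)

  upper-closed : ∀ {p q} → p ℚ.< q → upper p → upper q
  upper-closed p<q Up with located p<q
  ... | inj₁ Lp = contradiction (ordered Lp Up) (ℚ.<-irrefl refl)
  ... | inj₂ Uq = Uq

  upper-closed-≤ : ∀ {p q} → p ℚ.≤ q → upper p → upper q
  upper-closed-≤ p≤q Up with upper-open Up
  ... | _ , r<p , Ur = upper-closed (ℚ.<-≤-trans r<p p≤q) Ur

open ℝ public

infix 4 _<_ _≤_ _≃_

_<_ : ℝ → ℝ → Set
x < y = ∃[ r ] (upper x r × lower y r)

_≤_ : ℝ → ℝ → Set
x ≤ y = ∀ {r} → lower x r → lower y r

_≃_ : ℝ → ℝ → Set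
x ≃ y = x ≤ y × y ≤ x

fromℚ : ℚ → ℝ
fromℚ r = record
  { lower           = ℚ._< r
  ; upper           = r ℚ.<_
  ; lower-inhabited = r ℚ.- 1ℚ , p-1<p r
  ; upper-inhabited = r ℚ.+ 1ℚ , p<p+q r 0<1
  ; lower-open      = ℚ.<-dense
  ; upper-open      = λ r<q → let m , r<m , m<q = ℚ.<-dense r<q in m , m<q , r<m
  ; ordered         = ℚ.<-trans
  ; located         = loc
  }
  where
  loc : ∀ {p q} → p ℚ.< q → p ℚ.< r ⊎ r ℚ.< q
  loc {p} p<q with ≤⊎> r p
  ... | inj₁ r≤p = inj₂ (ℚ.≤-<-trans r≤p p<q)
  ... | inj₂ p<r = inj₁ p<r

infix  8 -_
infixl 6 _+_ _-_ _⊔_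

-_ : ℝ → ℝ
- x = record
  { lower           = λ p → upper x (ℚ.- p)
  ; upper           = λ p → lower x (ℚ.- p)
  ; lower-inhabited = let u , Uu = upper-inhabited x in
                      ℚ.- u , subst (upper x) (sym (neg-invol u)) Uu
  ; upper-inhabited = let l , Ll = lower-inhabited x in
                      ℚ.- l , subst (lower x) (sym (neg-invol l)) Ll
  ; lower-open      = λ U-p → let r , r<-p , Ur = upper-open x U-p in
                      ℚ.- r , <-neg r<-p , subst (upper x) (sym (neg-invol r)) Ur
  ; upper-open      = λ L-q → let r , -q<r , Lr = lower-open x L-q in
                      ℚ.- r , neg-< -q<r , subst (lower x) (sym (neg-invol r)) Lr
  ; ordered         = λ {p} {q} U-p L-q →
                      subst₂ ℚ._<_ (neg-invol p) (neg-invol q)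
                        (ℚ.neg-antimono-< (ordered x L-q U-p))
  ; located         = loc
  }
  where
  loc : ∀ {p q} → p ℚ.< q → upper x (ℚ.- p) ⊎ lower x (ℚ.- q)
  loc p<q with located x (ℚ.neg-antimono-< p<q)
  ... | inj₁ L-q = inj₂ L-q
  ... | inj₂ U-p = inj₁ U-p

_⊔_ : ℝ → ℝ → ℝ
x ⊔ y = record
  { lower           = λ p → lower x p ⊎ lower y p
  ; upper           = λ q → upper x q × upper y q
  ; lower-inhabited = let l , Ll = lower-inhabited x in l , inj₁ Ll
  ; upper-inhabited = u-inh
  ; lower-open      = l-open
  ; upper-open      = u-open
  ; ordered         = λ { (inj₁ Lp) (Uq , _) → ordered x Lp Uq
                        ; (inj₂ Lp) (_ , Uq) → ordered y Lp Uq }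
  ; located         = loc
  }
  where
  common : ∀ {p q} → upper x p → upper y q → upper x (p ℚ.⊔ q) × upper y (p ℚ.⊔ q)
  common {p} {q} Up Uq = upper-closed-≤ x (ℚ.p≤p⊔q p q) Up
                       , upper-closed-≤ y (ℚ.p≤q⊔p p q) Uq

  u-inh : ∃[ u ] (upper x u × upper y u)
  u-inh = let p , Up = upper-inhabited x
              q , Uq = upper-inhabited y in p ℚ.⊔ q , common Up Uq

  l-open : ∀ {p} → lower x p ⊎ lower y p → ∃[ q ] (p ℚ.< q × (lower x q ⊎ lower y q))
  l-open (inj₁ Lp) = let q , p<q , Lq = lower-open x Lp in q , p<q , inj₁ Lq
  l-open (inj₂ Lp) = let q , p<q , Lq = lower-open y Lp in q , p<q , inj₂ Lq

  u-open : ∀ {q} → upper x q × upper y q → ∃[ p ] (p ℚ.< q × (upper x p × upper y p))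
  u-open (Uq , Vq) with upper-open x Uq | upper-open y Vq
  ... | p , p<q , Up | r , r<q , Vr with ℚ.≤-total p r
  ... | inj₁ p≤r = r , r<q , upper-closed-≤ x p≤r Up , Vr
  ... | inj₂ r≤p = p , p<q , Up , upper-closed-≤ y r≤p Vr

  loc : ∀ {p q} → p ℚ.< q → (lower x p ⊎ lower y p) ⊎ (upper x q × upper y q)
  loc p<q with located x p<q | located y p<q
  ... | inj₁ Lp | _       = inj₁ (inj₁ Lp)
  ... | inj₂ _  | inj₁ Lp = inj₁ (inj₂ Lp)
  ... | inj₂ Uq | inj₂ Vq = inj₂ (Uq , Vq)

∣_∣ : ℝ → ℝ
∣ x ∣ = x ⊔ (- x)

abstract
  approximate-grid : ∀ x {l δ} → lower x l → 0ℚ ℚ.< δ → ∃[ k ]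
    (lower x (l ℚ.+ fromℕ k ℚ.* δ) × upper x (l ℚ.+ fromℕ (2 ℕ.+ k) ℚ.* δ))
  approximate-grid x {l} {δ} Ll 0<δ
    with upper-inhabited x
  ... | u , Uu with archimedean-* (u ℚ.- l) 0<δ
  ... | N , u-l≤Nδ = walk N 0 L₀ bound
    where
    open ℚ.≤-Reasoning
    open +-*-Solver
    pt : ℕ → ℚ
    pt k = l ℚ.+ fromℕ k ℚ.* δ

    step : ∀ k → pt k ℚ.< pt (suc k)
    step k = ℚ.+-monoʳ-< l (*-monoʳ-< 0<δ
      (subst (fromℕ k ℚ.<_) (ℚ.+-comm (fromℕ k) 1ℚ) (p<p+q (fromℕ k) 0<1)))

    L₀ : lower x (pt 0)
    L₀ = subst (lower x) (sym (trans (cong (l ℚ.+_) (ℚ.*-zeroˡ δ)) (ℚ.+-identityʳ l))) Ll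

    bound : u ℚ.≤ pt (N ℕ.+ 0)
    bound = begin
      u                ≡⟨ solve 2 (λ u l → u := l :+ (u :- l)) refl u l ⟩
      l ℚ.+ (u ℚ.- l)  ≤⟨ ℚ.+-monoʳ-≤ l u-l≤Nδ ⟩
      pt N             ≡⟨ cong pt (ℕ.+-identityʳ N) ⟨
      pt (N ℕ.+ 0)     ∎

    walk : ∀ n k → lower x (pt k) → u ℚ.≤ pt (n ℕ.+ k) →
           ∃[ k ] (lower x (pt k) × upper x (pt (2 ℕ.+ k)))
    walk zero k Lk u≤ =
      contradiction (ℚ.<-≤-trans (ordered x Lk Uu) u≤) (ℚ.<-irrefl refl)
    walk (suc n) k Lk u≤ with located x (step (suc k))
    ... | inj₁ L = walk n (suc k) L (subst (λ i → u ℚ.≤ pt i) (sym (ℕ.+-suc n k)) u≤)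
    ... | inj₂ U = k , Lk , U

  approximate : ∀ x {l δ} → lower x l → 0ℚ ℚ.< δ →
    ∃[ a ] (l ℚ.≤ a × lower x a × upper x (a ℚ.+ (δ ℚ.+ δ)))
  approximate x {l} {δ} Ll 0<δ = coarsen (approximate-grid x Ll 0<δ)
    where
    open +-*-Solver
    suc-* : ∀ k → fromℕ (suc k) ℚ.* δ ≡ δ ℚ.+ fromℕ k ℚ.* δ
    suc-* k = trans (ℚ.*-distribʳ-+ δ 1ℚ (fromℕ k))
                    (cong (ℚ._+ fromℕ k ℚ.* δ) (ℚ.*-identityˡ δ))
    shift : ∀ k → l ℚ.+ fromℕ (2 ℕ.+ k) ℚ.* δ ≡ l ℚ.+ fromℕ k ℚ.* δ ℚ.+ (δ ℚ.+ δ)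
    shift k = trans
      (cong (ℚ._+_ l) (trans (suc-* (suc k)) (cong (ℚ._+_ δ) (suc-* k))))
      (solve 3 (λ l d e → l :+ (d :+ (d :+ e)) := l :+ e :+ (d :+ d)) refl l δ (fromℕ k ℚ.* δ))
    coarsen : ∃[ k ] (lower x (l ℚ.+ fromℕ k ℚ.* δ) × upper x (l ℚ.+ fromℕ (2 ℕ.+ k) ℚ.* δ)) →
              ∃[ a ] (l ℚ.≤ a × lower x a × upper x (a ℚ.+ (δ ℚ.+ δ)))
    coarsen (k , L , U) = l ℚ.+ fromℕ k ℚ.* δ
      , p≤p+q l (subst (ℚ._≤ fromℕ k ℚ.* δ) (ℚ.*-zeroˡ δ)
                  (*-monoʳ-≤ (ℚ.<⇒≤ 0<δ) (fromℕ≥0 k)))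
      , L
      , subst (upper x) (shift k) U

_+_ : ℝ → ℝ → ℝ
x + y = record
  { lower           = Low
  ; upper           = Upp
  ; lower-inhabited =
      let a , La = lower-inhabited x
          b , Lb = lower-inhabited y
      in a ℚ.+ b ℚ.- 1ℚ , a , b , La , Lb , p-1<p (a ℚ.+ b)
  ; upper-inhabited =
      let a , Ua = upper-inhabited x
          b , Ub = upper-inhabited y
      in a ℚ.+ b ℚ.+ 1ℚ , a , b , Ua , Ub , p<p+q (a ℚ.+ b) 0<1
  ; lower-open      = λ (a , b , La , Lb , p<) →
      let m , p<m , m< = ℚ.<-dense p< in m , p<m , a , b , La , Lb , m<
  ; upper-open      = λ (a , b , Ua , Ub , <q) →
      let m , <m , m<q = ℚ.<-dense <q in m , m<q , a , b , Ua , Ub , <m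
  ; ordered         = λ (_ , _ , La , Lb , p<) (_ , _ , Ua , Ub , <q) →
      ℚ.<-trans p< (ℚ.<-trans (ℚ.+-mono-< (ordered x La Ua) (ordered y Lb Ub)) <q)
  ; located         = loc
  }
  where
  Low Upp : ℚ → Set
  Low p = ∃[ a ] ∃[ b ] (lower x a × lower y b × p ℚ.< a ℚ.+ b)
  Upp q = ∃[ a ] ∃[ b ] (upper x a × upper y b × a ℚ.+ b ℚ.< q)

  loc : ∀ {p q} → p ℚ.< q → Low p ⊎ Upp q
  loc {p} {q} p<q with quarter (p<q⇒0<q-p p<q)
  ... | d , 0<d , 4d<q-p
    with approximate x (proj₂ (lower-inhabited x)) 0<d
       | approximate y (proj₂ (lower-inhabited y)) 0<d
  ... | a , _ , La , Ua | b , _ , Lb , Ub with ≤⊎> (a ℚ.+ b) p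
  ... | inj₂ p<a+b = inj₁ (a , b , La , Lb , p<a+b)
  ... | inj₁ a+b≤p = inj₂ (a ℚ.+ (d ℚ.+ d) , b ℚ.+ (d ℚ.+ d) , Ua , Ub
                          , sum-bound p q a b (d ℚ.+ d) a+b≤p 4d<q-p)

_-_ : ℝ → ℝ → ℝ
x - y = x + (- y)

1ℝ : ℝ
1ℝ = fromℚ 1ℚ

record ℝ⁺ : Set₁ where
  field
    value    : ℝ
    positive : lower value 0ℚ

  upper-positive : ∀ {u} → upper value u → 0ℚ ℚ.< u
  upper-positive = ordered value positive

  lower-positive : ∃[ l ] (0ℚ ℚ.< l × lower value l)
  lower-positive = lower-open value positive

open ℝ⁺ public

1ℝ⁺ : ℝ⁺
1ℝ⁺ = record { value = 1ℝ ; positive = 0<1 }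

infix  8 1/⁺_
infixl 6 _+⁺_
infixl 7 _*⁺_
infixr 8 _^⁺_ _^ʳ_

_+⁺_ : ℝ⁺ → ℝ⁺ → ℝ⁺
x +⁺ y = record
  { value    = value x + value y
  ; positive = let a , 0<a , La = lower-positive x
                   b , 0<b , Lb = lower-positive y in a , b , La , Lb , +-pos 0<a 0<b
  }

abstract
  approximate-ratio : ∀ x {u v} → 0ℚ ℚ.< u → u ℚ.< v → ∃[ a ] ∃[ c ]
    (0ℚ ℚ.< a × lower (value x) a × upper (value x) c × u ℚ.* c ℚ.< v ℚ.* a)
  approximate-ratio x {u} {v} 0<u u<v =
    let a₀ , 0<a₀ , La₀      = lower-positive x
        e , 0<e , 4e<        = quarter (*-pos (p<q⇒0<q-p u<v) 0<a₀)
        d , 0<d , du≡e       = quotient-pos 0<e 0<u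
        a , a₀≤a , La , Uc   = approximate (value x) La₀ 0<d
    in  a , a ℚ.+ (d ℚ.+ d) , ℚ.<-≤-trans 0<a₀ a₀≤a , La , Uc
        , ratio-bound u v a a₀ d e u<v a₀≤a 0<e 4e< du≡e

_*⁺_ : ℝ⁺ → ℝ⁺ → ℝ⁺
x *⁺ y = record
  { value = record
    { lower           = Low
    ; upper           = Upp
    ; lower-inhabited = 0ℚ , low₀
    ; upper-inhabited =
        let c , Uc = upper-inhabited X
            d , Ud = upper-inhabited Y
        in c ℚ.* d ℚ.+ 1ℚ , c , d , Uc , Ud , p<p+q _ 0<1
    ; lower-open      = λ (a , b , 0<a , 0<b , La , Lb , p<) →
        let m , p<m , m< = ℚ.<-dense p< in m , p<m , a , b , 0<a , 0<b , La , Lb , m<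
    ; upper-open      = λ (c , d , Uc , Ud , <q) →
        let m , <m , m<q = ℚ.<-dense <q in m , m<q , c , d , Uc , Ud , <m
    ; ordered         = λ (a , b , 0<a , 0<b , La , Lb , p<) (c , d , Uc , Ud , <q) →
        ℚ.<-trans p< (ℚ.<-trans (ℚ.<-trans (*-monoʳ-< 0<b (ordered X La Uc))
          (*-monoˡ-< (upper-positive x Uc) (ordered Y Lb Ud))) <q)
    ; located         = loc
    }
  ; positive = low₀
  }
  where
  X = value x
  Y = value y
  Low Upp : ℚ → Set
  Low p = ∃[ a ] ∃[ b ] (0ℚ ℚ.< a × 0ℚ ℚ.< b × lower X a × lower Y b × p ℚ.< a ℚ.* b)
  Upp q = ∃[ c ] ∃[ d ] (upper X c × upper Y d × c ℚ.* d ℚ.< q)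

  low₀ : Low 0ℚ
  low₀ = let a , 0<a , La = lower-positive x
             b , 0<b , Lb = lower-positive y in a , b , 0<a , 0<b , La , Lb , *-pos 0<a 0<b

  loc : ∀ {p q} → p ℚ.< q → Low p ⊎ Upp q
  loc {p} {q} p<q with ≤⊎> p 0ℚ
  ... | inj₁ p≤0 = let a , b , 0<a , 0<b , La , Lb , 0<ab = low₀ in
                   inj₁ (a , b , 0<a , 0<b , La , Lb , ℚ.≤-<-trans p≤0 0<ab)
  ... | inj₂ 0<p with ℚ.<-dense p<q
  ... | m , p<m , m<q
    with approximate-ratio x 0<p p<m | approximate-ratio y (ℚ.<-trans 0<p p<m) m<q
  ... | a , c , 0<a , La , Uc , pc<ma | b , d , 0<b , Lb , Ud , md<qb
    with ≤⊎> (a ℚ.* b) p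
  ... | inj₂ p<ab = inj₁ (a , b , 0<a , 0<b , La , Lb , p<ab)
  ... | inj₁ ab≤p = inj₂ (c , d , Uc , Ud
                          , product-bound p m q a b c d 0<p p<m m<q 0<a
                              (upper-positive y Ud) pc<ma md<qb ab≤p)

1/⁺_ : ℝ⁺ → ℝ⁺
1/⁺ x = record
  { value = record
    { lower           = Low
    ; upper           = Upp
    ; lower-inhabited = 0ℚ , low₀ ℚ.≤-refl
    ; upper-inhabited = upp
    ; lower-open      = λ {p} (u , Uu , pu<1) →
        let m , pu<m , m<1 = ℚ.<-dense pu<1
            r , ru≡m       = quotient m (upper-positive x Uu)
        in r , *-cancelʳ-< (upper-positive x Uu) (subst (p ℚ.* u ℚ.<_) (sym ru≡m) pu<m)
             , u , Uu , subst (ℚ._< 1ℚ) (sym ru≡m) m<1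
    ; upper-open      = λ {q} (l , 0<l , Ll , 1<ql) →
        let m , 1<m , m<ql = ℚ.<-dense 1<ql
            r , rl≡m       = quotient m 0<l
        in r , *-cancelʳ-< 0<l (subst (ℚ._< q ℚ.* l) (sym rl≡m) m<ql)
             , l , 0<l , Ll , subst (1ℚ ℚ.<_) (sym rl≡m) 1<m
    ; ordered         = ord
    ; located         = loc
    }
  ; positive = low₀ ℚ.≤-refl
  }
  where
  open ℚ.≤-Reasoning
  X = value x
  Low Upp : ℚ → Set
  Low p = ∃[ u ] (upper X u × p ℚ.* u ℚ.< 1ℚ)
  Upp q = ∃[ l ] (0ℚ ℚ.< l × lower X l × 1ℚ ℚ.< q ℚ.* l)

  low₀ : ∀ {p} → p ℚ.≤ 0ℚ → Low p
  low₀ {p} p≤0 = let u , Uu = upper-inhabited X in u , Uu , (begin-strict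
    p  ℚ.* u  ≤⟨ *-monoʳ-≤ (ℚ.<⇒≤ (upper-positive x Uu)) p≤0 ⟩
    0ℚ ℚ.* u  ≡⟨ ℚ.*-zeroˡ u ⟩
    0ℚ        <⟨ 0<1 ⟩
    1ℚ        ∎)

  upp : ∃ Upp
  upp = let l , 0<l , Ll = lower-positive x
            r , rl≡2     = quotient (1ℚ ℚ.+ 1ℚ) 0<l
        in r , l , 0<l , Ll , subst (1ℚ ℚ.<_) (sym rl≡2) (p<p+q 1ℚ 0<1)

  ord : ∀ {p q} → Low p → Upp q → p ℚ.< q
  ord {p} {q} (u , Uu , pu<1) (l , 0<l , Ll , 1<ql) with ≤⊎> q p
  ... | inj₂ p<q = p<q
  ... | inj₁ q≤p = contradiction (begin-strict
    q ℚ.* l  ≤⟨ *-monoʳ-≤ (ℚ.<⇒≤ 0<l) q≤p ⟩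
    p ℚ.* l  <⟨ *-monoˡ-< (ℚ.<-≤-trans (*-pos⁻¹ 0<l (ℚ.<-trans 0<1 1<ql)) q≤p)
                          (ordered X Ll Uu) ⟩
    p ℚ.* u  <⟨ pu<1 ⟩
    1ℚ       <⟨ 1<ql ⟩
    q ℚ.* l  ∎) (ℚ.<-irrefl refl)

  loc : ∀ {p q} → p ℚ.< q → Low p ⊎ Upp q
  loc {p} {q} p<q with ≤⊎> p 0ℚ
  ... | inj₁ p≤0 = inj₁ (low₀ p≤0)
  ... | inj₂ 0<p with inverse 0<p | inverse (ℚ.<-trans 0<p p<q)
  ... | i , 0<i , pi≡1 | j , 0<j , qj≡1 with located X j<i
    where
    j<i : j ℚ.< i
    j<i = *-cancelˡ-< 0<p (begin-strict
      p ℚ.* j  <⟨ *-monoʳ-< 0<j p<q ⟩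
      q ℚ.* j  ≡⟨ trans qj≡1 (sym pi≡1) ⟩
      p ℚ.* i  ∎)
  ... | inj₁ Lj = let l , j<l , Ll = lower-open X Lj in
    inj₂ (l , ℚ.<-trans 0<j j<l , Ll
         , subst (ℚ._< q ℚ.* l) qj≡1 (*-monoˡ-< (ℚ.<-trans 0<p p<q) j<l))
  ... | inj₂ Ui = let u , u<i , Uu = upper-open X Ui in
    inj₁ (u , Uu , subst (p ℚ.* u ℚ.<_) pi≡1 (*-monoˡ-< 0<p u<i))

_^⁺_ : ℝ⁺ → ℕ → ℝ⁺
x ^⁺ zero  = 1ℝ⁺
x ^⁺ suc n = x *⁺ x ^⁺ n

-- The real power qˢ, as the supremum of q^(a/(1+n)) over the rationals
-- a/(1+n) below s and the infimum over those above s. Since s > 0 and q ≥ 1,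
-- natural a suffice. Roots are avoided: for r > 0, r ≤ q^(a/(1+n)) holds iff
-- r^(1+n) ≤ q^a. The intermediate r keeps the cut open even when q = 1.
_^ʳ_ : (q : ℕ) .{{_ : ℕ.NonZero q}} → ℝ⁺ → ℝ⁺
q ^ʳ s = record
  { value = record
    { lower           = Low
    ; upper           = Upp
    ; lower-inhabited = 0ℚ , low₀ 0<1
    ; upper-inhabited = upp
    ; lower-open      = λ (r , a , n , p<r , 0<r , La , r≤) →
        let m , p<m , m<r = ℚ.<-dense p<r in m , p<m , r , a , n , m<r , 0<r , La , r≤
    ; upper-open      = λ (r , a , n , r<p , 0<r , Ua , ≤r) →
        let m , r<m , m<p = ℚ.<-dense r<p in m , m<p , r , a , n , r<m , 0<r , Ua , ≤r
    ; ordered         = ord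
    ; located         = loc
    }
  ; positive = low₀ 0<1
  }
  where
  open ℚ.≤-Reasoning
  S = value s
  c = fromℕ q
  1≤c = 1≤fromℕ q
  0<c = ℚ.<-≤-trans 0<1 1≤c
  Low Upp : ℚ → Set
  Low p = ∃[ r ] ∃[ a ] ∃[ n ]
    (p ℚ.< r × 0ℚ ℚ.< r × lower S (+ a ℚ./ suc n) × r ^ suc n ℚ.≤ c ^ a)
  Upp p = ∃[ r ] ∃[ a ] ∃[ n ]
    (r ℚ.< p × 0ℚ ℚ.< r × upper S (+ a ℚ./ suc n) × c ^ a ℚ.≤ r ^ suc n)

  low₀ : ∀ {p} → p ℚ.< 1ℚ → Low p
  low₀ p<1 = 1ℚ , 0 , 0 , p<1 , 0<1 , positive s , ℚ.≤-refl

  upp : ∃ Upp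
  upp = let u , Uu = upper-inhabited S
            N , u≤N = archimedean u
        in c ^ N ℚ.+ 1ℚ , c ^ N , N , 0 , p<p+q _ 0<1 , ^-pos N 0<c
         , upper-closed-≤ S (subst (u ℚ.≤_) (fromℕ≡/1 N) u≤N) Uu
         , ℚ.≤-reflexive (sym (ℚ.*-identityʳ (c ^ N)))

  ord : ∀ {p₁ p₂} → Low p₁ → Upp p₂ → p₁ ℚ.< p₂
  ord (r₁ , a , m , p<r₁ , 0<r₁ , La , r₁≤) (r₂ , b , n , r₂<p , 0<r₂ , Ub , ≤r₂) =
    ℚ.<-trans (ℚ.<-≤-trans p<r₁ (^-cancelˡ-≤ (n ℕ.+ m ℕ.* suc n) 0<r₂ (begin
      r₁ ^ (suc m ℕ.* suc n)   ≡⟨ ^-assocʳ r₁ (suc m) (suc n) ⟨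
      (r₁ ^ suc m) ^ suc n     ≤⟨ ^-monoˡ-≤ (suc n) (^-pos (suc m) 0<r₁) r₁≤ ⟩
      (c ^ a) ^ suc n          ≡⟨ ^-assocʳ c a (suc n) ⟩
      c ^ (a ℕ.* suc n)        ≤⟨ ^-monoʳ-≤ 1≤c (ℕ.<⇒≤ (/-<⇒ a m b n (ordered S La Ub))) ⟩
      c ^ (b ℕ.* suc m)        ≡⟨ ^-assocʳ c b (suc m) ⟨
      (c ^ b) ^ suc m          ≤⟨ ^-monoˡ-≤ (suc m) (^-pos b 0<c) ≤r₂ ⟩
      (r₂ ^ suc n) ^ suc m     ≡⟨ ^-assocʳ r₂ (suc n) (suc m) ⟩
      r₂ ^ (suc n ℕ.* suc m)   ≡⟨ cong (r₂ ^_) (ℕ.*-comm (suc n) (suc m)) ⟩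
      r₂ ^ (suc m ℕ.* suc n)   ∎))) r₂<p

  grid : ∀ n k → 0ℚ ℚ.+ fromℕ k ℚ.* (+ 1 ℚ./ suc n) ≡ + k ℚ./ suc n
  grid n k = trans (ℚ.+-identityˡ _) (fromℕ-* k n)

  loc : ∀ {p₁ p₂} → p₁ ℚ.< p₂ → Low p₁ ⊎ Upp p₂
  loc {p₁} {p₂} p₁<p₂ with ≤⊎> p₁ 0ℚ
  ... | inj₁ p₁≤0 = inj₁ (low₀ (ℚ.≤-<-trans p₁≤0 0<1))
  ... | inj₂ 0<p₁ with ℚ.<-dense p₁<p₂
  ... | m₂ , p₁<m₂ , m₂<p₂ with ℚ.<-dense p₁<m₂
  ... | m₁ , p₁<m₁ , m₁<m₂ with ^-grows (c ^ 2) (ℚ.<-trans 0<p₁ p₁<m₁) m₁<m₂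
  ... | n , c²m₁≤m₂ with approximate-grid S (positive s) (1/suc-pos n)
  ... | k , L , U with ≤⊎> (m₁ ^ suc n) (c ^ k)
  ... | inj₁ m₁≤ = inj₁ (m₁ , k , n , p₁<m₁ , ℚ.<-trans 0<p₁ p₁<m₁
                        , subst (lower S) (grid n k) L , m₁≤)
  ... | inj₂ <m₁ = inj₂ (m₂ , 2 ℕ.+ k , n , m₂<p₂
                        , ℚ.<-trans 0<p₁ (ℚ.<-trans p₁<m₁ m₁<m₂)
                        , subst (upper S) (grid n (2 ℕ.+ k)) U , (begin
      c ^ (2 ℕ.+ k)           ≡⟨ ^-homo-* c 2 k ⟩
      c ^ 2 ℚ.* c ^ k         ≤⟨ *-monoˡ-≤ (ℚ.<⇒≤ (^-pos 2 0<c)) (ℚ.<⇒≤ <m₁) ⟩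
      c ^ 2 ℚ.* m₁ ^ suc n    ≤⟨ c²m₁≤m₂ ⟩
      m₂ ^ suc n              ∎))

Irrational : ℝ → Set
Irrational α = ∀ r → ¬ α ≃ fromℚ r

data Extended⁺ : Set₁ where
  finite : ℝ⁺ → Extended⁺
  ∞      : Extended⁺

infix 4 _<∞_

_<∞_ : Extended⁺ → Extended⁺ → Set
finite x <∞ finite y = value x < value y
finite _ <∞ ∞        = ⊤
∞        <∞ _        = ⊥

ExponentBound : ℝ → ℝ⁺ → Set₁
ExponentBound α μ = ∀ (ε : ℝ⁺) → ∃[ Q ] (0 ℕ.< Q ×
  (∀ (p : ℤ) (q : ℕ) .{{_ : ℕ.NonZero q}} → Q ℕ.≤ q →
     value (1/⁺ (q ^ʳ (μ +⁺ ε))) < ∣ α - fromℚ (p ℚ./ q) ∣))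

BaseBound : ℝ → ℝ⁺ → Set₁
BaseBound α β = 1ℝ ≤ value β × (∀ (ε : ℝ⁺) → ∃[ Q ] (0 ℕ.< Q ×
  (∀ (p : ℤ) (q : ℕ) .{{_ : ℕ.NonZero q}} → Q ℕ.≤ q →
     value (1/⁺ ((β +⁺ ε) ^⁺ q)) < ∣ α - fromℚ (p ℚ./ q) ∣)))

IsLeast : (ℝ⁺ → Set₁) → ℝ⁺ → Set₁
IsLeast P x = P x × (∀ y → P y → value x ≤ value y)

-- IrrationalityExponent α m means μ(α) = m; its values may not be computable,
-- hence a relation rather than a function. Likewise for the base.
IrrationalityExponent : ℝ → Extended⁺ → Set₁
IrrationalityExponent α (finite μ) = IsLeast (ExponentBound α) μ
IrrationalityExponent α ∞          = ¬ ∃ (ExponentBound α)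

IrrationalityBase : ℝ → Extended⁺ → Set₁
IrrationalityBase α (finite β) = IsLeast (BaseBound α) β
IrrationalityBase α ∞          = ¬ ∃ (BaseBound α)

-- μ(α) is finite as soon as some bound exists. Asking for the least bound
-- would be a stronger hypothesis constructively, though not classically.
FiniteExponent : ℝ → Set₁
FiniteExponent α = ∃ (ExponentBound α)

Liouville : ℝ → Set₁
Liouville α = IrrationalityExponent α ∞

SuperLiouville : ℝ → Set₁
SuperLiouville α = IrrationalityBase α ∞

BaseExceedsOne : ℝ → Set₁
BaseExceedsOne α = ∃[ b ] (IrrationalityBase α b × finite 1ℝ⁺ <∞ b)

{-# OPTIONS --safe #-}

-- A bound |α - p/q| > q^-(μ+1) for large q gives |α - p/q| > (1+ε)^-q for
-- large q, because q^N ≤ (1+h)^q for all large q whenever h > 0. This domination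
-- is obtained without logarithms, by induction on N: if (1+h)² ≤ 1+g then one
-- factor (1+h)^q absorbs q by Bernoulli's inequality and the other absorbs q^N.
module Submission where

open import Defs
open import Data.Integer.Base using (+_)
open import Data.Nat.Base as ℕ using (ℕ; zero; suc)
import Data.Nat.Properties as ℕ
open import Data.Product.Base using (∃-syntax; _×_; _,_; proj₁; proj₂)
open import Data.Rational.Base as ℚ using (ℚ; 0ℚ; 1ℚ)
import Data.Rational.Properties as ℚ
open import Data.Rational.Solver using (module +-*-Solver)
open import Relation.Binary.PropositionalEquality
  using (_≡_; refl; sym; trans; cong; subst)

open ℚ-Lemmas
open +-*-Solver
open ℚ.≤-Reasoning

abstract
  fromℕ-mono-≤ : ∀ {m n} → m ℕ.≤ n → fromℕ m ℚ.≤ fromℕ n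
  fromℕ-mono-≤ {n = n} ℕ.z≤n = fromℕ≥0 n
  fromℕ-mono-≤ (ℕ.s≤s m≤n) = ℚ.+-monoʳ-≤ 1ℚ (fromℕ-mono-≤ m≤n)

  -- h = g / (2 + g) ≤ g, hence 2h + h² ≤ h (2 + g) = g.
  [1+h]²≤1+g : ∀ {g h} → 0ℚ ℚ.< g → 0ℚ ℚ.< h → h ℚ.* (1ℚ ℚ.+ 1ℚ ℚ.+ g) ≡ g →
    (1ℚ ℚ.+ h) ℚ.* (1ℚ ℚ.+ h) ℚ.≤ 1ℚ ℚ.+ g
  [1+h]²≤1+g {g} {h} 0<g 0<h h[2+g]≡g = begin
    (1ℚ ℚ.+ h) ℚ.* (1ℚ ℚ.+ h)
      ≡⟨ solve 1 (λ h → (con 1ℚ :+ h) :* (con 1ℚ :+ h)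
                     := con 1ℚ :+ h :* (con 1ℚ :+ con 1ℚ :+ h)) refl h ⟩
    1ℚ ℚ.+ h ℚ.* (1ℚ ℚ.+ 1ℚ ℚ.+ h)
      ≤⟨ ℚ.+-monoʳ-≤ 1ℚ (*-monoˡ-≤ (ℚ.<⇒≤ 0<h) (ℚ.+-monoʳ-≤ (1ℚ ℚ.+ 1ℚ) h≤g)) ⟩
    1ℚ ℚ.+ h ℚ.* (1ℚ ℚ.+ 1ℚ ℚ.+ g)
      ≡⟨ cong (ℚ._+_ 1ℚ) h[2+g]≡g ⟩
    1ℚ ℚ.+ g ∎
    where
    h≤g : h ℚ.≤ g
    h≤g = begin
      h
        ≡⟨ ℚ.*-identityʳ h ⟨
      h ℚ.* 1ℚ
        ≤⟨ *-monoˡ-≤ (ℚ.<⇒≤ 0<h) (p≤p+q 1ℚ (ℚ.<⇒≤ (+-pos 0<1 0<g))) ⟩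
      h ℚ.* (1ℚ ℚ.+ (1ℚ ℚ.+ g))
        ≡⟨ cong (h ℚ.*_) (ℚ.+-assoc 1ℚ 1ℚ g) ⟨
      h ℚ.* (1ℚ ℚ.+ 1ℚ ℚ.+ g)
        ≡⟨ h[2+g]≡g ⟩
      g ∎

  below-sqrt : ∀ {g} → 0ℚ ℚ.< g →
    ∃[ h ] (0ℚ ℚ.< h × (1ℚ ℚ.+ h) ℚ.* (1ℚ ℚ.+ h) ℚ.≤ 1ℚ ℚ.+ g)
  below-sqrt {g} 0<g =
    let h , 0<h , h[2+g]≡g = quotient-pos 0<g (+-pos (+-pos 0<1 0<1) 0<g)
    in h , 0<h , [1+h]²≤1+g 0<g 0<h h[2+g]≡g

  -- Bernoulli gives `q * h ≤ (1 + h) ^ q`, so `C` can be the inverse of `h`.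
  linear≤exponential : ∀ {h} → 0ℚ ℚ.< h →
    ∃[ C ] (0ℚ ℚ.< C × (∀ q → fromℕ q ℚ.≤ C ℚ.* (1ℚ ℚ.+ h) ^ q))
  linear≤exponential {h} 0<h with inverse 0<h
  ... | i , 0<i , hi≡1 = i , 0<i , λ q → begin
    fromℕ q
      ≡⟨ ℚ.*-identityʳ (fromℕ q) ⟨
    fromℕ q ℚ.* 1ℚ
      ≡⟨ cong (fromℕ q ℚ.*_) hi≡1 ⟨
    fromℕ q ℚ.* (h ℚ.* i)
      ≡⟨ solve 3 (λ q h i → q :* (h :* i) := i :* (q :* h)) refl (fromℕ q) h i ⟩
    i ℚ.* (fromℕ q ℚ.* h)
      ≤⟨ *-monoˡ-≤ (ℚ.<⇒≤ 0<i) (p≤p+q _ (ℚ.<⇒≤ 0<1)) ⟩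
    i ℚ.* (fromℕ q ℚ.* h ℚ.+ 1ℚ)
      ≡⟨ cong (i ℚ.*_) (ℚ.+-comm (fromℕ q ℚ.* h) 1ℚ) ⟩
    i ℚ.* (1ℚ ℚ.+ fromℕ q ℚ.* h)
      ≤⟨ *-monoˡ-≤ (ℚ.<⇒≤ 0<i) (bernoulli q 0<h) ⟩
    i ℚ.* (1ℚ ℚ.+ h) ^ q ∎

  *-mono-≤-scaled : ∀ {x y} c d e → 0ℚ ℚ.≤ x → 0ℚ ℚ.≤ d ℚ.* e →
    x ℚ.≤ c ℚ.* e → y ℚ.≤ d ℚ.* e → x ℚ.* y ℚ.≤ c ℚ.* d ℚ.* (e ℚ.* e)
  *-mono-≤-scaled {x} {y} c d e 0≤x 0≤de x≤ce y≤de = begin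
    x ℚ.* y                    ≤⟨ *-monoˡ-≤ 0≤x y≤de ⟩
    x ℚ.* (d ℚ.* e)            ≤⟨ *-monoʳ-≤ 0≤de x≤ce ⟩
    (c ℚ.* e) ℚ.* (d ℚ.* e)
      ≡⟨ solve 3 (λ c d e → (c :* e) :* (d :* e) := (c :* d) :* (e :* e)) refl c d e ⟩
    c ℚ.* d ℚ.* (e ℚ.* e)      ∎

  ^*^≤^ : ∀ {p r} q → 0ℚ ℚ.< p → p ℚ.* p ℚ.≤ r → p ^ q ℚ.* p ^ q ℚ.≤ r ^ q
  ^*^≤^ {p} {r} q 0<p p²≤r = begin
    p ^ q ℚ.* p ^ q    ≡⟨ ^-distrib-* p p q ⟨
    (p ℚ.* p) ^ q      ≤⟨ ^-monoˡ-≤ q (*-pos 0<p 0<p) p²≤r ⟩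
    r ^ q              ∎

  power≤exponential : ∀ N {g} → 0ℚ ℚ.< g →
    ∃[ C ] (0ℚ ℚ.< C × (∀ q → fromℕ q ^ N ℚ.≤ C ℚ.* (1ℚ ℚ.+ g) ^ q))
  power≤exponential zero {g} 0<g = 1ℚ , 0<1 , λ q →
    subst (1ℚ ℚ.≤_) (sym (ℚ.*-identityˡ ((1ℚ ℚ.+ g) ^ q))) (1≤^ q (p≤p+q 1ℚ (ℚ.<⇒≤ 0<g)))
  power≤exponential (suc N) 0<g =
    let h , 0<h , [1+h]²≤ = below-sqrt 0<g
        C , 0<C , q≤      = linear≤exponential 0<h
        -- The induction hypothesis is used at the smaller base `1 + h`, so the induction on `N`
        -- must leave `g` free.
        D , 0<D , q^N≤    = power≤exponential N 0<h
        0<1+h             = +-pos 0<1 0<h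
    in C ℚ.* D , *-pos 0<C 0<D , λ q → ℚ.≤-trans
      (*-mono-≤-scaled C D ((1ℚ ℚ.+ h) ^ q) (fromℕ≥0 q)
        (ℚ.<⇒≤ (*-pos 0<D (^-pos q 0<1+h))) (q≤ q) (q^N≤ q))
      (*-monoˡ-≤ (ℚ.<⇒≤ (*-pos 0<C 0<D)) (^*^≤^ q 0<1+h [1+h]²≤))

  cancel-scaled : ∀ {c x y z} → 0ℚ ℚ.< c → c ℚ.≤ x → 0ℚ ℚ.≤ y →
    x ℚ.* y ℚ.≤ c ℚ.* z → y ℚ.≤ z
  cancel-scaled {c} 0<c c≤x 0≤y xy≤cz =
    ℚ.*-cancelˡ-≤-pos c {{ℚ.positive 0<c}} (ℚ.≤-trans (*-monoʳ-≤ 0≤y c≤x) xy≤cz)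

  -- The constant for the exponent 1 + N is cancelled against the spare factor q.
  eventually-power≤exponential : ∀ N {h} → 0ℚ ℚ.< h →
    ∃[ K ] (∀ q → K ℕ.≤ q → fromℕ q ^ N ℚ.≤ (1ℚ ℚ.+ h) ^ q)
  eventually-power≤exponential N 0<h =
    let C , 0<C , q^[1+N]≤ = power≤exponential (suc N) 0<h
        K , C≤K            = archimedean C
    in K , λ q K≤q →
      let C≤q = ℚ.≤-trans C≤K (fromℕ-mono-≤ K≤q)
      in cancel-scaled 0<C C≤q (ℚ.<⇒≤ (^-pos N (ℚ.<-≤-trans 0<C C≤q))) (q^[1+N]≤ q)

upper-fromℕ : ∀ x → ∃[ N ] upper x (fromℕ N)
upper-fromℕ x =
  let u , Uu  = upper-inhabited x
      N , u≤N = archimedean u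
  in N , upper-closed-≤ x u≤N Uu

-- A witness for `l` has `a / (1+n)` below `s`, hence below `N`. As `q` is at least 1, its power
-- obeys `r ^ (1+n) ≤ q ^ a ≤ (q ^ N) ^ (1+n)`, and the root is cancelled. Strictness comes from
-- `l < r`.
lower-^ʳ⇒<^ : ∀ q .{{_ : ℕ.NonZero q}} s N {l} → upper (value s) (fromℕ N) →
  lower (value (q ^ʳ s)) l → l ℚ.< fromℕ q ^ N
lower-^ʳ⇒<^ q s N {l} U (r , a , n , l<r , 0<r , La , r^≤q^a) =
  ℚ.<-≤-trans l<r (^-cancelˡ-≤ n (^-pos N 0<q) (begin
    r ^ suc n               ≤⟨ r^≤q^a ⟩
    fromℕ q ^ a             ≤⟨ ^-monoʳ-≤ (1≤fromℕ q) (ℕ.<⇒≤ a<N[1+n]) ⟩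
    fromℕ q ^ (N ℕ.* suc n) ≡⟨ ^-assocʳ (fromℕ q) N (suc n) ⟨
    (fromℕ q ^ N) ^ suc n   ∎))
  where
  0<q : 0ℚ ℚ.< fromℕ q
  0<q = ℚ.<-≤-trans 0<1 (1≤fromℕ q)
  a<N[1+n] : a ℕ.< N ℕ.* suc n
  a<N[1+n] = subst (ℕ._< N ℕ.* suc n) (ℕ.*-identityʳ a)
    -- Reading `N` as `N / 1` leaves a factor 1 on `a` after cross-multiplication.
    (/-<⇒ a n N 0 (subst (+ a ℚ./ suc n ℚ.<_) (fromℕ≡/1 N) (ordered (value s) La U)))

<^⇒lower-^⁺ : ∀ x {a} n {p} → lower (value x) a → 0ℚ ℚ.< a → 0ℚ ℚ.≤ p →
  p ℚ.< a ^ n → lower (value (x ^⁺ n)) p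
<^⇒lower-^⁺ x zero La 0<a 0≤p p<1 = p<1
<^⇒lower-^⁺ x {a} (suc n) {p} La 0<a 0≤p p<a^ =
  -- The cut of a product asks for a factor `b` with `p < a * b`, yet `b` must stay strictly below
  -- `a ^ n` for the recursion. Taking `b = m / a` with `m` strictly in between meets both; `0 ≤ p`
  -- makes `b` positive.
  let m , p<m , m<a^   = ℚ.<-dense p<a^
      b , 0<b , ba≡m   = quotient-pos (ℚ.≤-<-trans 0≤p p<m) 0<a
      ab≡m             = trans (ℚ.*-comm a b) ba≡m
  in a , b , 0<a , 0<b , La
   , <^⇒lower-^⁺ x n La 0<a (ℚ.<⇒≤ 0<b)
       (*-cancelˡ-< 0<a (subst (ℚ._< a ℚ.* a ^ n) (sym ab≡m) m<a^))
   , subst (p ℚ.<_) (sym ab≡m) p<m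

-- The cut of 1 does not contain 1 itself, so the sum is formed from `1 - d` and some `b` below `ε`.
-- It exceeds `1 + d` once `2d < b`.
lower-1+ : ∀ ε → ∃[ h ] (0ℚ ℚ.< h × lower (value (1ℝ⁺ +⁺ ε)) (1ℚ ℚ.+ h))
lower-1+ ε =
  let b , 0<b , Lb   = lower-positive ε
      d , 0<d , 4d<b = quarter 0<b
  in d , 0<d , 1ℚ ℚ.- d , b , 1-d<1 0<d , Lb , 1+d<1-d+b 0<d 4d<b
  where
  1-d<1 : ∀ {d} → 0ℚ ℚ.< d → 1ℚ ℚ.- d ℚ.< 1ℚ
  1-d<1 0<d = ℚ.+-monoʳ-< 1ℚ (ℚ.neg-antimono-< 0<d)
  1+d<1-d+b : ∀ {b d} → 0ℚ ℚ.< d → (d ℚ.+ d) ℚ.+ (d ℚ.+ d) ℚ.< b →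
    1ℚ ℚ.+ d ℚ.< (1ℚ ℚ.- d) ℚ.+ b
  1+d<1-d+b {b} {d} 0<d 4d<b = begin-strict
    1ℚ ℚ.+ d
      ≡⟨ solve 1 (λ d → con 1ℚ :+ d := (con 1ℚ :- d) :+ (d :+ d)) refl d ⟩
    (1ℚ ℚ.- d) ℚ.+ (d ℚ.+ d)
      <⟨ ℚ.+-monoʳ-< (1ℚ ℚ.- d) (ℚ.<-trans (p<p+q _ (+-pos 0<d 0<d)) 4d<b) ⟩
    (1ℚ ℚ.- d) ℚ.+ b ∎

-- The upper cut of a reciprocal is witnessed by positive members of the lower cut, so only these
-- need comparing, and the separating rational `r` is kept.
1/⁺-antitone-< : ∀ x y {z} → (∀ {l} → 0ℚ ℚ.< l → lower (value x) l → lower (value y) l) →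
  value (1/⁺ x) < z → value (1/⁺ y) < z
1/⁺-antitone-< x y x≤y (r , (l , 0<l , Ll , 1<rl) , Lr) =
  r , (l , 0<l , x≤y 0<l Ll , 1<rl) , Lr

eventually-^ʳ≤^⁺ : ∀ s ε → ∃[ K ] (∀ q .{{_ : ℕ.NonZero q}} → K ℕ.≤ q →
  ∀ {l} → 0ℚ ℚ.< l → lower (value (q ^ʳ s)) l → lower (value ((1ℝ⁺ +⁺ ε) ^⁺ q)) l)
eventually-^ʳ≤^⁺ s ε =
  let N , UN       = upper-fromℕ (value s)
      h , 0<h , Lh = lower-1+ ε
      K , q^N≤     = eventually-power≤exponential N 0<h
  in K , λ q K≤q 0<l Ll → <^⇒lower-^⁺ (1ℝ⁺ +⁺ ε) q Lh (+-pos 0<1 0<h) (ℚ.<⇒≤ 0<l)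
       (ℚ.<-≤-trans (lower-^ʳ⇒<^ q s N UN Ll) (q^N≤ q K≤q))

finiteExponent⇒baseBound-1 : ∀ α → FiniteExponent α → BaseBound α 1ℝ⁺
finiteExponent⇒baseBound-1 α (μ , bound) = (λ p<1 → p<1) , λ ε →
  -- Any fixed slack would do, since every power of `q` is eventually dominated; 1 is taken.
  let Q , 0<Q , μ-bound = bound 1ℝ⁺
      K , q^ʳ≤          = eventually-^ʳ≤^⁺ (μ +⁺ 1ℝ⁺) ε
  -- The sum serves as a common threshold above both `Q` and `K`.
  in Q ℕ.+ K , ℕ.≤-trans 0<Q (ℕ.m≤m+n Q K) , λ p q Q+K≤q →
     1/⁺-antitone-< (q ^ʳ (μ +⁺ 1ℝ⁺)) ((1ℝ⁺ +⁺ ε) ^⁺ q) {∣ α - fromℚ (p ℚ./ q) ∣}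
       (q^ʳ≤ q (ℕ.≤-trans (ℕ.m≤n+m K Q) Q+K≤q))
       (μ-bound p q (ℕ.≤-trans (ℕ.m≤m+n Q K) Q+K≤q))

lemma2 : (α : ℝ) → Irrational α →
    (FiniteExponent α → IrrationalityBase α (finite 1ℝ⁺))
    × (BaseExceedsOne α → Liouville α)
    × (SuperLiouville α → Liouville α)
lemma2 α _ = base≡1 , liouville , superLiouville
  where
  base≡1 : FiniteExponent α → IrrationalityBase α (finite 1ℝ⁺)
  -- Leastness is immediate: `BaseBound` itself contains the inequality `1 ≤ β`.
  base≡1 fin = finiteExponent⇒baseBound-1 α fin , λ _ → proj₁

  superLiouville : SuperLiouville α → Liouville α
  superLiouville ¬bound fin = ¬bound (1ℝ⁺ , finiteExponent⇒baseBound-1 α fin)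

  liouville : BaseExceedsOne α → Liouville α
  liouville (∞ , ¬bound , _) = superLiouville ¬bound
  liouville (finite β , (_ , least) , r , 1<r , Lr) fin =
    -- Leastness of `β` against the bound 1 sends `r`, which lies below `β`, below 1.
    ℚ.<-asym 1<r (least 1ℝ⁺ (finiteExponent⇒baseBound-1 α fin) Lr)
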